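{- Let $s\ge 4$ be an integer and $G\in\mathcal G^s_2$. Then $\lambda(G)\ge v(G)/(s+1)$.
   Context: All graphs are finite and simple. For integers $1\le r\le s$, $\mathcal G^s_r$ denotes the set of graphs in which every vertex has degree at least $r$ and at most $s$. $v(G)$ is the number of vertices of $G$. $\lambda(G)$ denotes the maximum number of pairwise vertex-disjoint subgraphs of $G$ each of which is a path with exactly two edges. -}

module Defs where

open import Data.Fin using (Fin; _≟_)
open import Data.Fin.Properties using (any?; injective⇒≤)
open import Data.Fin.Subset using (Subset; ∣_∣)
open import Data.Nat using (ℕ; zero; suc; _≤_)
open import Data.Nat.Properties using (m≤n⇒m<n∨m≡n; ≤-pred)
open import Data.Product using (∃; _×_; _,_; proj₁; proj₂)
open import Data.Sum using (inj₁; inj₂)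
open import Data.Vec using (Vec; []; _∷_; map; head; lookup; tabulate)
open import Data.Vec.Membership.DecPropositional using (_∈?_)
open import Data.Vec.Membership.Propositional using (_∉_)
open import Data.Vec.Relation.Unary.All as All using (All; []; _∷_)
open import Data.Vec.Relation.Unary.Any using (here)
import Data.Vec.Relation.Unary.AllPairs as AllPairs
open AllPairs using (allPairs?)
import Data.Vec.Relation.Unary.AllPairs.Properties as AllPairsₚ
open import Data.Vec.Relation.Unary.AllPairs.Core using (AllPairs; []; _∷_)
open import Data.Vec.Relation.Unary.Linked using (Linked; linked?)
open import Data.Vec.Relation.Unary.Unique.Propositional using (Unique)
open import Data.Vec.Relation.Unary.Unique.Propositional.Properties using (lookup-injective)
open import Level using (0ℓ)
open import Relation.Binary using (Rel; Decidable; Symmetric)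
open import Relation.Binary.PropositionalEquality using (_≡_; refl)
open import Relation.Nullary using (Dec; yes; no; ¬_; does; ¬?; contradiction)
open import Relation.Nullary.Decidable using (map′; _×-dec_)
import Relation.Unary as U

record Graph : Set₁ where
  infix 4 _~_ _~?_
  field
    v        : ℕ
    _~_      : Rel (Fin v) 0ℓ
    _~?_     : Decidable _~_
    ~-sym    : Symmetric _~_
    ~-irrefl : ∀ {x} → ¬ (x ~ x)

  Vertex : Set
  Vertex = Fin v

  neighbours : Vertex → Subset v
  neighbours x = tabulate (λ y → does (x ~? y))

  degree : Vertex → ℕ
  degree x = ∣ neighbours x ∣

open Graph public using (v)

𝒢 : (r s : ℕ) → Graph → Set
𝒢 r s G = ∀ x → r ≤ degree x × degree x ≤ s
  where open Graph G

IsGreatest : (ℕ → Set) → ℕ → Set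
IsGreatest P k = P k × (∀ {j} → P j → j ≤ k)

-- A nonempty decidable set of natural numbers with an upper bound has a
-- greatest element.
greatest : {P : ℕ → Set} → U.Decidable P → P 0 →
           ∀ b → (∀ {j} → P j → j ≤ b) → ∃ (IsGreatest P)
greatest {P} P? p₀ zero    bounded = 0 , p₀ , bounded
greatest {P} P? p₀ (suc b) bounded with P? (suc b)
... | yes p = suc b , p , bounded
... | no ¬p = greatest P? p₀ b below
  where
  below : ∀ {j} → P j → j ≤ b
  below pⱼ with m≤n⇒m<n∨m≡n (bounded pⱼ)
  ... | inj₁ j<1+b = ≤-pred j<1+b
  ... | inj₂ refl  = contradiction pⱼ ¬p

-- Decidable existential quantification over a type.
Searchable : Set → Set₁
Searchable A = {P : A → Set} → U.Decidable P → Dec (∃ P)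

vec-searchable : {A : Set} → Searchable A → ∀ n → Searchable (Vec A n)
vec-searchable any-A? zero    P? =
  map′ (λ p → [] , p) (λ { ([] , p) → p }) (P? [])
vec-searchable any-A? (suc n) P? =
  map′ (λ { (x , xs , p) → x ∷ xs , p }) (λ { (x ∷ xs , p) → x , xs , p })
       (any-A? λ x → vec-searchable any-A? n λ xs → P? (x ∷ xs))

module _ (G : Graph) where
  open Graph G hiding (v)

  -- A path with m edges, given by its vertices in order.  As a subgraph its
  -- edges are those joining consecutive entries.  The two orderings of one
  -- path share all their vertices, so they never occur in a common packing.
  IsPath : ∀ {m} → Vec Vertex (suc m) → Set
  IsPath xs = Unique xs × Linked _~_ xs

  Disjoint : ∀ {m n} → Vec Vertex m → Vec Vertex n → Set
  Disjoint xs ys = All (_∉ ys) xs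

  IsPacking : ∀ {k} → Vec (Vec Vertex 3) k → Set
  IsPacking ps = All IsPath ps × AllPairs Disjoint ps

  HasPacking : ℕ → Set
  HasPacking k = ∃ λ (ps : Vec (Vec Vertex 3) k) → IsPacking ps

  isPath? : ∀ {m} → U.Decidable (IsPath {m})
  isPath? xs = allPairs? (λ x y → ¬? (x ≟ y)) xs ×-dec linked? _~?_ xs

  disjoint? : ∀ {m n} → Decidable (Disjoint {m} {n})
  disjoint? xs ys = All.all? (λ x → ¬? (_∈?_ _≟_ x ys)) xs

  hasPacking? : U.Decidable HasPacking
  hasPacking? k = vec-searchable (vec-searchable any? 3) k
    (λ ps → All.all? isPath? ps ×-dec allPairs? disjoint? ps)

  -- The first vertices of the paths in a packing are distinct.
  packing-bounded : ∀ {k} → HasPacking k → k ≤ v G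
  packing-bounded (ps , _ , disjoint) =
    injective⇒≤ (λ {i} {j} → lookup-injective heads-unique i j)
    where
    heads-differ : ∀ {xs ys} → Disjoint {3} {3} xs ys → ¬ (head xs ≡ head ys)
    heads-differ {ys = _ ∷ _} (x∉ys ∷ _) refl = x∉ys (here refl)

    heads-unique : Unique (map head ps)
    heads-unique = AllPairsₚ.map⁺ (AllPairs.map heads-differ disjoint)

  maximumPacking : ∃ (IsGreatest HasPacking)
  maximumPacking = greatest hasPacking? ([] , [] , []) (v G) packing-bounded

  -- The invariant λ(G); the name λ itself is reserved in Agda.
  λᴳ : ℕ
  λᴳ = proj₁ maximumPacking

  λᴳ-isGreatest : IsGreatest HasPacking λᴳ
  λᴳ-isGreatest = proj₂ maximumPacking

{-# OPTIONS --safe #-}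

-- The degree hypothesis is relaxed so that edges can be removed: if all degrees
-- are at most s, then (s + 1) λ is at least the number of vertices of degree at
-- least 2, by induction on the number of edges.  It suffices to delete k disjoint
-- 2-edge paths so that at most k (s + 1) vertices stop having degree ≥ 2.
-- An edge with no end of degree exactly 2 can be dropped, so every neighbour of
-- a vertex of degree ≥ 3 has degree 2.  A leaf z – y – a costs only the closed
-- neighbourhood of a; three consecutive vertices of degree 2 cost five vertices,
-- which is where s ≥ 4 enters.  If two neighbours of a lead directly to further
-- vertices of degree ≥ 3, delete the path through a and these two neighbours.
-- Otherwise each vertex a of degree ≥ 3 starts threads a – y – z – t with y, z of
-- degree 2 and t of degree ≥ 3; follow them until a centre repeats and delete
-- all the paths a – y – z, which costs the closed neighbourhoods of the centres.
module Submission where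

open import Defs
open import Data.Integer using (+_)
open import Data.Nat using (ℕ; suc; _≤_)
open import Data.Rational using (_/_; _≥_)
open import Data.Bool using (true; false)
open import Data.Empty using (⊥-elim)
open import Data.Fin using (Fin; zero; suc; _≟_)
open import Data.Fin.Properties using (any?; injective⇒≤)
open import Data.Fin.Subset using (∣_∣; ⁅_⁆)
import Data.Fin.Subset as Subset
open import Data.Fin.Subset.Properties using (p⊆q⇒∣p∣≤∣q∣; ∣⊥∣≡0; ∣⁅x⁆∣≡1; x∈⁅x⁆)
import Data.Integer as ℤ
import Data.Integer.Properties as ℤₚ
open import Data.List as List using (List; []; _∷_; _++_; length; filter; allFin; concatMap; cartesianProduct)
open import Data.List.Membership.Propositional using (_∈_; lose)
open import Data.List.Membership.Propositional.Properties
  using (∈-filter⁺; ∈-filter⁻; ∈-allFin; ∈-++⁺ˡ; ∈-++⁺ʳ; ∈-cartesianProduct⁺)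
import Data.List.Membership.DecPropositional as DecMembership
import Data.List.Membership.Setoid.Properties as Membershipₛ
open import Data.List.Properties using (length-++; filter-notAll)
open import Data.List.Relation.Unary.Any using (here; there)
open import Data.Nat using (zero; z≤n; s≤s; _+_; _*_; _<_)
open import Data.Nat.Induction using (<-wellFounded)
open import Data.Nat.Properties
  using (≤-trans; ≤-reflexive; +-mono-≤; *-distribʳ-+; +-suc; *-monoˡ-≤; 1+n≰n; m≤m+n)
open import Data.Product using (∃; ∃-syntax; _×_; _,_; proj₁; proj₂; uncurry) renaming (swap to ×-swap)
open import Data.Product.Properties using (≡-dec)
open import Data.Rational.Properties using (toℚᵘ-cancel-≤; toℚᵘ-fromℚᵘ)
import Data.Rational.Unnormalised as ℚᵘ
import Data.Rational.Unnormalised.Properties as ℚᵘₚ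
open import Data.Sum as Sum using (_⊎_; inj₁; inj₂; [_,_]′)
open import Data.Vec as Vec using (Vec; []; _∷_; tabulate)
open import Data.Vec.Membership.DecPropositional using (_∈?_)
import Data.Vec.Membership.Propositional as Vec
import Data.Vec.Properties as Vecₚ
open import Data.Vec.Relation.Unary.All as VecAll using ([]; _∷_)
import Data.Vec.Relation.Unary.All.Properties as VecAllₚ
open import Data.Vec.Relation.Unary.Any as VecAny using (here; there)
import Data.Vec.Relation.Unary.Any.Properties as VecAnyₚ
open import Data.Vec.Relation.Unary.AllPairs.Core using ([]; _∷_)
import Data.Vec.Relation.Unary.AllPairs.Properties as AllPairsₚ
open import Data.Vec.Relation.Unary.Linked using ([-]; _∷_)
open import Function using (_∘_; id)
open import Induction.WellFounded using (Acc; acc)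
open import Level using (0ℓ)
open import Relation.Binary using (Rel; Decidable; Symmetric)
open import Relation.Binary.PropositionalEquality
  using (_≡_; _≢_; refl; sym; trans; cong; subst; subst₂; setoid; ≢-sym)
open import Relation.Nullary using (yes; no; ¬_; ¬?; does; contradiction)
open import Relation.Nullary.Decidable using (_×-dec_)
import Relation.Unary as U

-- Counting with lists and subsets.

length-filter-tabulate : ∀ {n} {A : Set} {P : A → Set} (P? : U.Decidable P) (f : Fin n → A) →
                         length (filter P? (List.tabulate f)) ≡ ∣ tabulate (does ∘ P? ∘ f) ∣
length-filter-tabulate {zero}  P? f = refl
length-filter-tabulate {suc n} P? f with does (P? (f zero))
... | true  = cong suc (length-filter-tabulate P? (f ∘ suc))
... | false = length-filter-tabulate P? (f ∘ suc)

-- Sending each element to a position where it occurs is injective.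
exhaustive⇒≤length : ∀ {n} (xs : List (Fin n)) → (∀ x → x ∈ xs) → n ≤ length xs
exhaustive⇒≤length xs all∈ =
  injective⇒≤ λ {i} {j} → Membershipₛ.index-injective (setoid _) (all∈ i) (all∈ j)

∈⇒All : ∀ {A : Set} {P : A → Set} {n} {xs : Vec A n} → (∀ {x} → x Vec.∈ xs → P x) → VecAll.All P xs
∈⇒All {xs = []}     f = []
∈⇒All {xs = x ∷ xs} f = f (here refl) ∷ ∈⇒All (f ∘ there)

-- Subgraphs and vertex degrees inside them.

module _ (G : Graph) where
  open Graph G hiding (v)

  -- The vertex set never shrinks: a vertex is deleted by removing the edges at it. Each edge is
  -- listed in both directions, and the length of the list is the induction measure.
  record Subgraph : Set where
    field
      edges   : List (Vertex × Vertex)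
      –-sym   : ∀ {x y} → (x , y) ∈ edges → (y , x) ∈ edges
      –⇒~     : ∀ {x y} → (x , y) ∈ edges → x ~ y

  open Subgraph

  Touched : ∀ {k} → Vec (Vec Vertex 3) k → Vertex → Set
  Touched ps x = VecAny.Any (x Vec.∈_) ps

  touched? : ∀ {k} (ps : Vec (Vec Vertex 3) k) → U.Decidable (Touched ps)
  touched? ps x = VecAny.any? (_∈?_ _≟_ x) ps

  module Local (H : Subgraph) where

    infix 4 _–_ _–?_

    _–_ : Rel Vertex 0ℓ
    x – y = (x , y) ∈ edges H

    _–?_ : Decidable _–_
    x –? y = DecMembership._∈?_ (≡-dec _≟_ _≟_) (x , y) (edges H)

    flip– : Symmetric _–_
    flip– = –-sym H

    –⇒≢ : ∀ {x y} → x – y → x ≢ y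
    –⇒≢ xy refl = ~-irrefl (–⇒~ H xy)

    Deg2+ : Vertex → Set
    Deg2+ x = ∃[ u ] ∃[ v ] u ≢ v × x – u × x – v

    -- `Leaf`, `Two` and `Many` certify degree 1, 2 and at least 3 by naming neighbours, so degrees
    -- inside a subgraph are never counted.
    record Leaf (x u : Vertex) : Set where
      constructor leaf
      field
        nbr  : x – u
        only : ∀ {w} → x – w → w ≡ u

    record Two (x u v : Vertex) : Set where
      constructor two
      field
        distinct : u ≢ v
        nbr₁     : x – u
        nbr₂     : x – v
        only     : ∀ {w} → x – w → w ≡ u ⊎ w ≡ v

    record Many (x : Vertex) : Set where
      constructor many
      field
        {u v w} : Vertex
        u≢v     : u ≢ v
        u≢w     : u ≢ w
        v≢w     : v ≢ w
        x–u     : x – u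
        x–v     : x – v
        x–w     : x – w

    data View (x : Vertex) : Set where
      isolated : (∀ {w} → ¬ x – w) → View x
      leaf     : ∀ {u} → Leaf x u → View x
      two      : ∀ {u v} → Two x u v → View x
      many     : Many x → View x

    view : ∀ x → View x
    view x with any? (x –?_)
    ... | no none = isolated λ xw → none (_ , xw)
    ... | yes (u , xu) with any? (λ v → (x –? v) ×-dec ¬? (u ≟ v))
    ...   | no none = leaf (leaf xu only)
      where
      only : ∀ {w} → x – w → w ≡ u
      only {w} xw with u ≟ w
      ... | yes eq = sym eq
      ... | no neq = contradiction (_ , xw , neq) none
    ...   | yes (v , xv , u≢v) with any? (λ w → (x –? w) ×-dec ¬? (u ≟ w) ×-dec ¬? (v ≟ w))
    ...     | yes (w , xw , u≢w , v≢w) = many (many u≢v u≢w v≢w xu xv xw)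
    ...     | no none = two (two u≢v xu xv only)
      where
      only : ∀ {w} → x – w → w ≡ u ⊎ w ≡ v
      only {w} xw with u ≟ w | v ≟ w
      ... | yes eq | _      = inj₁ (sym eq)
      ... | no _   | yes eq = inj₂ (sym eq)
      ... | no u≢w | no v≢w = contradiction (_ , xw , u≢w , v≢w) none

    swap : ∀ {x u v} → Two x u v → Two x v u
    swap (two u≢v xu xv only) = two (≢-sym u≢v) xv xu (Sum.swap ∘ only)

    orient : ∀ {x u v a} → Two x u v → x – a → ∃ (Two x a)
    orient t xa with Two.only t xa
    ... | inj₁ refl = _ , t
    ... | inj₂ refl = _ , swap t

    two⇒¬many : ∀ {x a b} → Two x a b → ¬ Many x
    two⇒¬many (two _ _ _ only) (many u≢v u≢w v≢w xu xv xw) with only xu | only xv | only xw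
    ... | inj₁ refl | inj₁ refl | _         = u≢v refl
    ... | inj₁ refl | inj₂ refl | inj₁ refl = u≢w refl
    ... | inj₁ refl | inj₂ refl | inj₂ refl = v≢w refl
    ... | inj₂ refl | inj₁ refl | inj₁ refl = v≢w refl
    ... | inj₂ refl | inj₁ refl | inj₂ refl = u≢w refl
    ... | inj₂ refl | inj₂ refl | _         = u≢v refl

    leaf⇒¬deg2+ : ∀ {x a} → Leaf x a → ¬ Deg2+ x
    leaf⇒¬deg2+ l (_ , _ , u≢v , xu , xv) = u≢v (trans (Leaf.only l xu) (sym (Leaf.only l xv)))

    Deg2+Avoiding : Vertex → Vertex → Set
    Deg2+Avoiding p x = ∃[ u ] ∃[ v ] u ≢ v × (x – u × u ≢ p) × (x – v × v ≢ p)

    -- At most one of three distinct neighbours is `p`, so losing the edge to `p` leaves degree at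
    -- least 2.
    many-avoiding : ∀ {x} → Many x → ∀ p → Deg2+Avoiding p x
    many-avoiding (many {u} {v} u≢v u≢w v≢w xu xv xw) p with u ≟ p | v ≟ p
    ... | yes refl | _        = _ , _ , v≢w , (xv , ≢-sym u≢v) , (xw , ≢-sym u≢w)
    ... | no u≢p   | yes refl = _ , _ , u≢w , (xu , u≢v) , (xw , ≢-sym v≢w)
    ... | no u≢p   | no v≢p   = _ , _ , u≢v , (xu , u≢p) , (xv , v≢p)

  open Local using (Deg2+)

  -- Bounds, and the deletion of edges and paths.

  module _ (s : ℕ) where

    -- Listing the vertices of degree ≥ 2 in cover, possibly with repetitions and
    -- superfluous entries, avoids counting them.
    record Bound (H : Subgraph) : Set where
      field
        {k}      : ℕ
        paths    : Vec (Vec Vertex 3) k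
        packing  : IsPacking G paths
        incident : ∀ {x} → Touched paths x → ∃ (Local._–_ H x)
        cover    : List Vertex
        size     : length cover ≤ k * suc s
        covers   : ∀ {w} → Deg2+ H w → w ∈ cover

    module Reduction (4≤s : 4 ≤ s) (degree≤s : ∀ x → degree x ≤ s) (H : Subgraph)
      (IH : ∀ H′ → length (edges H′) < length (edges H) → Bound H′) where

      open Local H hiding (Deg2+)

      -- The closed neighbourhood is taken in `G`, where the degree bound is assumed; it contains
      -- all neighbours in `H` as well.
      ball : Vertex → List Vertex
      ball a = a ∷ filter (a ~?_) (allFin _)

      length-ball : ∀ a → length (ball a) ≤ suc s
      length-ball a = s≤s (≤-trans (≤-reflexive (length-filter-tabulate (a ~?_) id)) (degree≤s a))

      nbr∈ball : ∀ {a x} → a – x → x ∈ ball a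
      nbr∈ball {a} ax = there (∈-filter⁺ (a ~?_) (∈-allFin _) (–⇒~ H ax))

      module _ {Keep : Rel Vertex 0ℓ} (keep? : Decidable Keep) (keep-sym : Symmetric Keep) where

        restrict : Subgraph
        restrict = record
          { edges = filter (uncurry keep?) (edges H)
          ; –-sym = λ xy → let xy∈H , keep = ∈-filter⁻ (uncurry keep?) xy in
                           ∈-filter⁺ (uncurry keep?) (flip– xy∈H) (keep-sym keep)
          ; –⇒~   = –⇒~ H ∘ proj₁ ∘ ∈-filter⁻ (uncurry keep?)
          }

        Survives : Vertex → Set
        Survives w = ∃[ u ] ∃[ v ] u ≢ v × (w – u × Keep w u) × (w – v × Keep w v)

        -- The dropped edge shortens the list, so `IH` applies to `restrict`. A vertex of degree at
        -- least 2 is either charged to `W`, with a budget of `suc s` per new path, or keeps such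
        -- degree and is covered recursively.
        reduce : ∀ {x y} → x – y → ¬ Keep x y →
                 ∀ {k} (ps : Vec (Vec Vertex 3) k) → IsPacking G ps →
                 (∀ {x} → Touched ps x → ∃ (x –_)) →
                 (∀ {x y} → Touched ps x → ¬ Keep x y) →
                 (W : List Vertex) → length W ≤ k * suc s →
                 (∀ {w} → Deg2+ H w → w ∈ W ⊎ Survives w) →
                 Bound H
        reduce x–y drop {k} ps (are-paths , disjoint) incident detached W size covers = record
          { paths    = ps Vec.++ B.paths
          ; packing  = VecAllₚ.++⁺ are-paths (proj₁ B.packing)
                     , AllPairsₚ.++⁺ disjoint (proj₂ B.packing)
                         -- A vertex of `ps` has no edge left in `restrict`, while a vertex of
                         -- `B.paths` has one, so the two packings are disjoint.
                         (∈⇒All λ p∈ps → ∈⇒All λ q∈qs → ∈⇒All λ x∈p x∈q →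
                           let _ , xu = B.incident (VecAny.map (λ { refl → x∈q }) q∈qs) in
                           detached (VecAny.map (λ { refl → x∈p }) p∈ps) (proj₂ (kept xu)))
          ; incident = λ t → [ incident , (λ t′ → _ , proj₁ (kept (proj₂ (B.incident t′)))) ]′
                              (VecAnyₚ.++⁻ ps t)
          ; cover    = W ++ B.cover
          ; size     = ≤-trans (≤-reflexive (length-++ W))
                         (≤-trans (+-mono-≤ size B.size)
                                  (≤-reflexive (sym (*-distribʳ-+ (suc s) k B.k))))
          ; covers   = λ d → [ ∈-++⁺ˡ , ∈-++⁺ʳ W ∘ B.covers ∘ survives ]′ (covers d)
          }
          where
          module B = Bound (IH restrict
            (filter-notAll (uncurry keep?) (edges H) (lose x–y drop)))

          kept : ∀ {x y} → (x , y) ∈ edges restrict → x – y × Keep x y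
          kept = ∈-filter⁻ (uncurry keep?)

          survives : ∀ {w} → Survives w → Deg2+ restrict w
          survives (u , v , u≢v , (wu , ku) , (wv , kv)) =
            u , v , u≢v , ∈-filter⁺ (uncurry keep?) wu ku , ∈-filter⁺ (uncurry keep?) wv kv

      -- No path is gained, so no vertex may drop below degree 2; only the two ends of the edge are
      -- at risk.
      delete-edge : ∀ {x y} → x – y → (Deg2+ H x → Deg2+Avoiding y x) →
                    (Deg2+ H y → Deg2+Avoiding x y) → Bound H
      delete-edge {x} {y} xy okˣ okʸ =
        reduce keep? (λ (p , q) → q ∘ ×-swap , p ∘ ×-swap) xy (λ k → proj₁ k (refl , refl))
          [] ([] , []) (λ ()) (λ ()) [] z≤n (inj₂ ∘ survives)
        where
        Keep : Rel Vertex 0ℓ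
        Keep u v = ¬ (u ≡ x × v ≡ y) × ¬ (u ≡ y × v ≡ x)

        keep? : Decidable Keep
        keep? u v = ¬? ((u ≟ x) ×-dec (v ≟ y)) ×-dec ¬? ((u ≟ y) ×-dec (v ≟ x))

        survives : ∀ {w} → Deg2+ H w → ∃[ u ] ∃[ v ] u ≢ v × (w – u × Keep w u) × (w – v × Keep w v)
        survives {w} d@(u , v , u≢v , wu , wv) with w ≟ x | w ≟ y
        ... | yes refl | _ = let u , v , u≢v , (wu , u≢y) , (wv , v≢y) = okˣ d in
          u , v , u≢v , (wu , u≢y ∘ proj₂ , λ (w≡y , _) → –⇒≢ xy w≡y)
                      , (wv , v≢y ∘ proj₂ , λ (w≡y , _) → –⇒≢ xy w≡y)
        ... | no w≢x | yes refl = let u , v , u≢v , (wu , u≢x) , (wv , v≢x) = okʸ d in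
          u , v , u≢v , (wu , w≢x ∘ proj₁ , u≢x ∘ proj₂) , (wv , w≢x ∘ proj₁ , v≢x ∘ proj₂)
        ... | no w≢x | no w≢y =
          u , v , u≢v , (wu , w≢x ∘ proj₁ , w≢y ∘ proj₁) , (wv , w≢x ∘ proj₁ , w≢y ∘ proj₁)

      Untouched2+ : ∀ {k} → Vec (Vec Vertex 3) k → Vertex → Set
      Untouched2+ ps w = ∃[ u ] ∃[ v ] u ≢ v × (w – u × ¬ Touched ps u) × (w – v × ¬ Touched ps v)

      -- Every edge with a touched end is removed. An untouched vertex loses edges only to touched
      -- neighbours, so `own` and `near` account for all vertices at risk.
      delete-paths : ∀ {k} (ps : Vec (Vec Vertex 3) k) → IsPacking G ps →
                     ∃ (Touched ps) → (∀ {x} → Touched ps x → ∃ (x –_)) →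
                     (W : List Vertex) → length W ≤ k * suc s →
                     (∀ {x} → Touched ps x → Deg2+ H x → x ∈ W) →
                     (∀ {x w} → Touched ps x → w – x → Deg2+ H w → w ∈ W ⊎ Untouched2+ ps w) →
                     Bound H
      delete-paths ps packing (x , x∈D) incident W size own near =
        reduce (λ u v → ¬? (touched? ps u) ×-dec ¬? (touched? ps v)) ×-swap
          (proj₂ (incident x∈D)) (λ k → proj₁ k x∈D)
          ps packing incident (λ t k → proj₁ k t) W size covers
        where
        covers : ∀ {w} → Deg2+ H w → w ∈ W ⊎ _
        covers {w} d@(u , v , u≢v , wu , wv) with touched? ps w
        ... | yes w∈D = inj₁ (own w∈D d)
        ... | no w∉D = Sum.map₂ (λ (u , v , u≢v , (wu , u∉D) , (wv , v∉D)) →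
                         u , v , u≢v , (wu , w∉D , u∉D) , (wv , w∉D , v∉D)) outcome
          where
          outcome : w ∈ W ⊎ Untouched2+ ps w
          outcome with touched? ps u | touched? ps v
          ... | yes u∈D | _       = near u∈D wu d
          ... | no _    | yes v∈D = near v∈D wv d
          ... | no u∉D  | no v∉D  = inj₂ (u , v , u≢v , (wu , u∉D) , (wv , v∉D))

      -- Deleting one path: leaves and five-vertex configurations.

      isPath : ∀ {x y z} → x – y → y – z → x ≢ z → IsPath G (x ∷ y ∷ z ∷ [])
      isPath xy yz x≢z =
        ((–⇒≢ xy ∷ x≢z ∷ []) ∷ (–⇒≢ yz ∷ []) ∷ [] ∷ []) , (–⇒~ H xy ∷ –⇒~ H yz ∷ [-])

      touched-path : ∀ {x y z w k} {ps : Vec (Vec Vertex 3) k} → Touched ((x ∷ y ∷ z ∷ []) ∷ ps) w →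
                     (w ≡ x ⊎ w ≡ y ⊎ w ≡ z) ⊎ Touched ps w
      touched-path (here (here eq))                 = inj₁ (inj₁ eq)
      touched-path (here (there (here eq)))         = inj₁ (inj₂ (inj₁ eq))
      touched-path (here (there (there (here eq)))) = inj₁ (inj₂ (inj₂ eq))
      touched-path (there t)                        = inj₂ t

      module _ {x y z} (xy : x – y) (yz : y – z) (x≢z : x ≢ z) where

        private
          path : Vec (Vec Vertex 3) 1
          path = (x ∷ y ∷ z ∷ []) ∷ []

          OnPath : Vertex → Set
          OnPath w = w ≡ x ⊎ w ≡ y ⊎ w ≡ z

          on-path : ∀ {w} → Touched path w → OnPath w
          on-path t with touched-path t
          ... | inj₁ p = p

        Clear : Vertex → Set
        Clear w = w ≢ x × w ≢ y × w ≢ z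

        delete-path : (W : List Vertex) → length W ≤ suc s →
                      (∀ {w} → OnPath w → Deg2+ H w → w ∈ W) →
                      (∀ {u w} → OnPath u → u – w → Deg2+ H w →
                         w ∈ W ⊎ ∃[ p ] ∃[ q ] p ≢ q × (w – p × Clear p) × (w – q × Clear q)) →
                      Bound H
        delete-path W size own near =
          delete-paths path ((isPath xy yz x≢z ∷ []) , ([] ∷ [])) (x , here (here refl)) (incident ∘ on-path)
            W (≤-trans size (m≤m+n _ 0)) (own ∘ on-path)
            λ t wu d → Sum.map₂ (λ (p , q , p≢q , (wp , cp) , (wq , cq)) →
                         p , q , p≢q , (wp , clear cp) , (wq , clear cq))
                       (near (on-path t) (flip– wu) d)
          where
          incident : ∀ {w} → OnPath w → ∃ (w –_)
          incident (inj₁ refl)        = _ , xy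
          incident (inj₂ (inj₁ refl)) = _ , yz
          incident (inj₂ (inj₂ refl)) = _ , flip– yz

          clear : ∀ {w} → Clear w → ¬ Touched path w
          clear (w≢x , w≢y , w≢z) t with on-path t
          ... | inj₁ eq        = w≢x eq
          ... | inj₂ (inj₁ eq) = w≢y eq
          ... | inj₂ (inj₂ eq) = w≢z eq

      leaf-bound : ∀ {z y} → Leaf z y → Bound H
      leaf-bound {z} {y} l with view y
      ... | isolated none = ⊥-elim (none (flip– (Leaf.nbr l)))
      ... | leaf l′ = delete-edge (Leaf.nbr l) (⊥-elim ∘ leaf⇒¬deg2+ l) (⊥-elim ∘ leaf⇒¬deg2+ l′)
      ... | many m  = delete-edge (Leaf.nbr l) (⊥-elim ∘ leaf⇒¬deg2+ l) (λ _ → many-avoiding m z)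
      ... | two t with orient t (flip– (Leaf.nbr l))
      ...   | a , two z≢a yz ya only = delete-path (flip– yz) ya z≢a (ball a) (length-ball a) own near
        where
        own : ∀ {w} → w ≡ z ⊎ w ≡ y ⊎ w ≡ a → Deg2+ H w → w ∈ ball a
        own (inj₁ refl)        d = ⊥-elim (leaf⇒¬deg2+ l d)
        own (inj₂ (inj₁ refl)) _ = nbr∈ball (flip– ya)
        own (inj₂ (inj₂ refl)) _ = here refl

        near : ∀ {u w} → u ≡ z ⊎ u ≡ y ⊎ u ≡ a → u – w → Deg2+ H w → w ∈ ball a ⊎ _
        near (inj₁ refl) zw d with refl ← Leaf.only l zw = inj₁ (nbr∈ball (flip– ya))
        near (inj₂ (inj₁ refl)) yw d with only yw
        ... | inj₁ refl = ⊥-elim (leaf⇒¬deg2+ l d)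
        ... | inj₂ refl = inj₁ (here refl)
        near (inj₂ (inj₂ refl)) aw d = inj₁ (nbr∈ball aw)

      five≤ : 5 ≤ suc s
      five≤ = s≤s 4≤s

      -- Only the path and the outer neighbours `p` and `q` are affected. These may coincide with
      -- each other or with path vertices, as on a triangle, since the cover tolerates repetitions.
      two-two-two : ∀ {p x y z q} → Two x y p → Two y x z → Two z y q → Bound H
      two-two-two {p} {x} {y} {z} {q} tx ty tz =
        delete-path (Two.nbr₁ tx) (Two.nbr₂ ty) (Two.distinct ty)
          (x ∷ y ∷ z ∷ p ∷ q ∷ []) five≤ own near
        where
        own : ∀ {w} → w ≡ x ⊎ w ≡ y ⊎ w ≡ z → Deg2+ H w → w ∈ (x ∷ y ∷ z ∷ p ∷ q ∷ [])
        own (inj₁ refl)        _ = here refl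
        own (inj₂ (inj₁ refl)) _ = there (here refl)
        own (inj₂ (inj₂ refl)) _ = there (there (here refl))

        near : ∀ {u w} → u ≡ x ⊎ u ≡ y ⊎ u ≡ z → u – w → Deg2+ H w → w ∈ (x ∷ y ∷ z ∷ p ∷ q ∷ []) ⊎ _
        near (inj₁ refl) xw _ with Two.only tx xw
        ... | inj₁ refl = inj₁ (there (here refl))
        ... | inj₂ refl = inj₁ (there (there (there (here refl))))
        near (inj₂ (inj₁ refl)) yw _ with Two.only ty yw
        ... | inj₁ refl = inj₁ (here refl)
        ... | inj₂ refl = inj₁ (there (there (here refl)))
        near (inj₂ (inj₂ refl)) zw _ with Two.only tz zw
        ... | inj₁ refl = inj₁ (there (here refl))
        ... | inj₂ refl = inj₁ (there (there (there (there (here refl)))))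

      -- Deleting `y₁ – b – y₂` affects, besides the path, only `a` and the one possible further
      -- neighbour `c` of `b`.
      five-cluster : ∀ {a b y₁ y₂ c} → y₁ ≢ y₂ → Two y₁ a b → Two y₂ a b →
                     (∀ {w} → b – w → w ≡ y₁ ⊎ w ≡ y₂ ⊎ w ≡ c) → Bound H
      five-cluster {a} {b} {y₁} {y₂} {c} y₁≢y₂ t₁ t₂ only =
        delete-path (Two.nbr₂ t₁) (flip– (Two.nbr₂ t₂)) y₁≢y₂ W five≤ own near
        where
        W = y₁ ∷ b ∷ y₂ ∷ a ∷ c ∷ []

        own : ∀ {w} → w ≡ y₁ ⊎ w ≡ b ⊎ w ≡ y₂ → Deg2+ H w → w ∈ W
        own (inj₁ refl)        _ = here refl
        own (inj₂ (inj₁ refl)) _ = there (here refl)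
        own (inj₂ (inj₂ refl)) _ = there (there (here refl))

        near : ∀ {u w} → u ≡ y₁ ⊎ u ≡ b ⊎ u ≡ y₂ → u – w → Deg2+ H w → w ∈ W ⊎ _
        near (inj₁ refl) yw _ with Two.only t₁ yw
        ... | inj₁ refl = inj₁ (there (there (there (here refl))))
        ... | inj₂ refl = inj₁ (there (here refl))
        near (inj₂ (inj₁ refl)) bw _ with only bw
        ... | inj₁ refl        = inj₁ (here refl)
        ... | inj₂ (inj₁ refl) = inj₁ (there (there (here refl)))
        ... | inj₂ (inj₂ refl) = inj₁ (there (there (there (there (here refl)))))
        near (inj₂ (inj₂ refl)) yw _ with Two.only t₂ yw
        ... | inj₁ refl = inj₁ (there (there (there (here refl))))
        ... | inj₂ refl = inj₁ (there (here refl))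

      -- Two short threads at one vertex.

      AvoidsBoth : Vertex → Vertex → Vertex → Set
      AvoidsBoth y₁ y₂ b = ∃[ p ] ∃[ q ] p ≢ q × (b – p × p ≢ y₁ × p ≢ y₂) × (b – q × q ≢ y₁ × q ≢ y₂)

      -- Deleting `y₁ – a – y₂` is paid for by `ball a`; only `b₁` and `b₂` can be affected outside
      -- it. Such a vertex is not adjacent to `a`, so its two neighbours avoiding `y₁` and `y₂` also
      -- avoid `a` and survive.
      cherry-bound : ∀ {a b₁ b₂ y₁ y₂} → y₁ ≢ y₂ → Two y₁ a b₁ → Two y₂ a b₂ →
                     AvoidsBoth y₁ y₂ b₁ → AvoidsBoth y₁ y₂ b₂ → Bound H
      cherry-bound {a} {b₁} {b₂} {y₁} {y₂} y₁≢y₂ t₁ t₂ ok₁ ok₂ =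
        delete-path (Two.nbr₁ t₁) (flip– (Two.nbr₁ t₂)) y₁≢y₂ (ball a) (length-ball a) own near
        where
        Result : Vertex → Set
        Result w = w ∈ ball a ⊎ ∃[ p ] ∃[ q ] p ≢ q × (w – p × p ≢ y₁ × p ≢ a × p ≢ y₂)
                                                    × (w – q × q ≢ y₁ × q ≢ a × q ≢ y₂)

        own : ∀ {w} → w ≡ y₁ ⊎ w ≡ a ⊎ w ≡ y₂ → Deg2+ H w → w ∈ ball a
        own (inj₁ refl)        _ = nbr∈ball (flip– (Two.nbr₁ t₁))
        own (inj₂ (inj₁ refl)) _ = here refl
        own (inj₂ (inj₂ refl)) _ = nbr∈ball (flip– (Two.nbr₁ t₂))

        far : ∀ {b} → AvoidsBoth y₁ y₂ b → Result b
        far {b} (p , q , p≢q , (bp , p≢y₁ , p≢y₂) , (bq , q≢y₁ , q≢y₂)) with a –? b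
        ... | yes ab = inj₁ (nbr∈ball ab)
        ... | no ¬ab = inj₂ (p , q , p≢q , (bp , p≢y₁ , (λ { refl → ¬ab (flip– bp) }) , p≢y₂)
                                         , (bq , q≢y₁ , (λ { refl → ¬ab (flip– bq) }) , q≢y₂))

        near : ∀ {u w} → u ≡ y₁ ⊎ u ≡ a ⊎ u ≡ y₂ → u – w → Deg2+ H w → Result w
        near (inj₁ refl) yw _ with Two.only t₁ yw
        ... | inj₁ refl = inj₁ (here refl)
        ... | inj₂ refl = far ok₁
        near (inj₂ (inj₁ refl)) aw _ = inj₁ (nbr∈ball aw)
        near (inj₂ (inj₂ refl)) yw _ with Two.only t₂ yw
        ... | inj₁ refl = inj₁ (here refl)
        ... | inj₂ refl = far ok₂

      -- Distinct ends lose only one of `y₁`, `y₂` each and have two neighbours to spare. A common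
      -- end loses both: with two further neighbours it survives, and otherwise `five-cluster`
      -- applies.
      two-short-threads : ∀ {a b₁ b₂ y₁ y₂} → y₁ ≢ y₂ → Two y₁ a b₁ → Two y₂ a b₂ →
                          Many b₁ → Many b₂ → Bound H
      two-short-threads {a} {b₁} {b₂} {y₁} {y₂} y₁≢y₂ t₁ t₂ m₁ m₂ with b₁ ≟ b₂
      ... | no b₁≢b₂ = cherry-bound y₁≢y₂ t₁ t₂ (avoids t₁ t₂ b₁≢b₂ m₁)
          (let p , q , p≢q , (bp , p≢y₂ , p≢y₁) , (bq , q≢y₂ , q≢y₁) = avoids t₂ t₁ (≢-sym b₁≢b₂) m₂ in
           p , q , p≢q , (bp , p≢y₁ , p≢y₂) , (bq , q≢y₁ , q≢y₂))
        where
        avoids : ∀ {y y′ b b′} → Two y a b → Two y′ a b′ → b ≢ b′ → Many b → AvoidsBoth y y′ b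
        avoids {y} {y′} {b} t t′ b≢b′ m =
          let p , q , p≢q , (bp , p≢y) , (bq , q≢y) = many-avoiding m y in
          p , q , p≢q , (bp , p≢y , other bp) , (bq , q≢y , other bq)
          where
          other : ∀ {p} → b – p → p ≢ y′
          -- The neighbours of `y′` are `a` and `b′`, and `b` differs from both.
          other bp refl with Two.only t′ (flip– bp)
          ... | inj₁ b≡a  = Two.distinct t (sym b≡a)
          ... | inj₂ b≡b′ = b≢b′ b≡b′
      ... | yes refl with any? (λ c → (b₁ –? c) ×-dec ¬? (c ≟ y₁) ×-dec ¬? (c ≟ y₂))
      -- Without a further neighbour of `b₁`, the slot `c` is filled by repeating `y₁`.
      ...   | no none = five-cluster {c = y₁} y₁≢y₂ t₁ t₂ only
        where
        only : ∀ {w} → b₁ – w → w ≡ y₁ ⊎ w ≡ y₂ ⊎ w ≡ y₁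
        only {w} bw with w ≟ y₁ | w ≟ y₂
        ... | yes eq | _      = inj₁ eq
        ... | no _   | yes eq = inj₂ (inj₁ eq)
        ... | no w≢y₁ | no w≢y₂ = contradiction (w , bw , w≢y₁ , w≢y₂) none
      ...   | yes (c , bc , c≢y₁ , c≢y₂)
        with any? (λ d → ¬? (c ≟ d) ×-dec (b₁ –? d) ×-dec ¬? (d ≟ y₁) ×-dec ¬? (d ≟ y₂))
      ...     | yes (d , c≢d , bd , d≢y₁ , d≢y₂) = cherry-bound y₁≢y₂ t₁ t₂ ok ok
        where
        ok : AvoidsBoth y₁ y₂ b₁
        ok = c , d , c≢d , (bc , c≢y₁ , c≢y₂) , (bd , d≢y₁ , d≢y₂)
      ...     | no none = five-cluster {c = c} y₁≢y₂ t₁ t₂ only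
        where
        only : ∀ {w} → b₁ – w → w ≡ y₁ ⊎ w ≡ y₂ ⊎ w ≡ c
        only {w} bw with w ≟ y₁ | w ≟ y₂ | c ≟ w
        ... | yes eq | _      | _      = inj₁ eq
        ... | no _   | yes eq | _      = inj₂ (inj₁ eq)
        ... | no _   | no _   | yes eq = inj₂ (inj₂ (sym eq))
        ... | no w≢y₁ | no w≢y₂ | no c≢w = contradiction (w , c≢w , bw , w≢y₁ , w≢y₂) none

      -- Threads and the walk along them.

      record Thread (a y z t : Vertex) : Set where
        constructor thread
        field
          inner₁ : Two y a z
          inner₂ : Two z y t
          end    : Many t

      data ThreadFrom (a y : Vertex) : Set where
        bound : Bound H → ThreadFrom a y
        short : ∀ {b} → Two y a b → Many b → ThreadFrom a y
        long  : ∀ {z t} → Thread a y z t → ThreadFrom a y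

      -- Leaving `a` through `y`, a leaf, an edge between two vertices of degree at least 3, or a
      -- third consecutive vertex of degree 2 gives a reduction at once. A long thread may return to
      -- `a` itself.
      thread-from : ∀ {a y} → Many a → a – y → ThreadFrom a y
      thread-from {a} {y} m ay with view y
      ... | isolated none = ⊥-elim (none (flip– ay))
      ... | leaf l = bound (leaf-bound l)
      ... | many m′ = bound (delete-edge ay (λ _ → many-avoiding m y) (λ _ → many-avoiding m′ a))
      ... | two t with orient t (flip– ay)
      ...   | b , ty with view b
      ...     | isolated none = ⊥-elim (none (flip– (Two.nbr₂ ty)))
      ...     | leaf l = bound (leaf-bound l)
      ...     | many m′ = short ty m′
      ...     | two t′ with orient t′ (flip– (Two.nbr₂ ty))
      ...       | c , tb with view c
      ...         | isolated none = ⊥-elim (none (flip– (Two.nbr₂ tb)))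
      ...         | leaf l = bound (leaf-bound l)
      ...         | many m″ = long (thread ty tb m″)
      ...         | two t″ with orient t″ (flip– (Two.nbr₂ tb))
      ...           | d , tc = bound (two-two-two (swap ty) tb tc)

      -- Excluding `p` keeps the walk from turning back along the thread it arrived by. Two exits
      -- remain, and if both are short they give a reduction together.
      next-thread : ∀ {a} → Many a → ∀ p → Bound H ⊎ ∃[ y ] ∃[ z ] ∃[ t ] y ≢ p × Thread a y z t
      next-thread m p with many-avoiding m p
      ... | u , v , u≢v , (au , u≢p) , (av , v≢p) with thread-from m au | thread-from m av
      ...   | bound b     | _           = inj₁ b
      ...   | long th     | _           = inj₂ (_ , _ , _ , u≢p , th)
      ...   | short _ _   | bound b     = inj₁ b
      ...   | short _ _   | long th     = inj₂ (_ , _ , _ , v≢p , th)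
      ...   | short tu mb | short tv mc = inj₁ (two-short-threads u≢v tu tv mb mc)

      -- ps are the paths a – y – z of the threads followed so far, t is the end of
      -- the last thread and p the vertex before it.
      record Walk {k} (ps : Vec (Vec Vertex 3) k) (p t : Vertex) : Set where
        field
          packing : IsPacking G ps
          centres : List Vertex
          size    : length centres ≡ k
          centre  : ∀ {x} → Touched ps x → Many x → x ∈ centres
          hook    : ∀ {x} → Touched ps x → ¬ Many x → ∃[ c ] x – c × Many c
          inside  : ∀ {x u} → Touched ps x → ¬ Many x → x – u → ¬ Many u → Touched ps u
          outside : ∀ {x u} → Touched ps x → ¬ Many x → x – u → Many u → u ∈ centres ⊎ x ≡ p × u ≡ t

      many? : U.Decidable Many
      many? x with view x
      ... | isolated none = no λ m → none (Many.x–u m)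
      ... | leaf l = no λ m → leaf⇒¬deg2+ l (_ , _ , Many.u≢v m , Many.x–u m , Many.x–v m)
      ... | two t = no (two⇒¬many t)
      ... | many m = yes m

      -- From touched vertices of degree below 3, only the edge `p – t` can lead to a vertex of
      -- degree at least 3 that is not a centre. Once `t` is a centre too, every touched vertex and
      -- all its neighbours lie in the balls of the centres, one ball per path.
      close : ∀ {k} {ps : Vec (Vec Vertex 3) k} {p t} → (W : Walk ps p t) → t ∈ Walk.centres W →
              ∃ (Touched ps) → Bound H
      close {k} {ps} {p} {t} W t∈cs some =
        delete-paths ps packing some incident (concatMap ball centres)
          (subst (λ k → length (concatMap ball centres) ≤ k * suc s) size (length-balls centres))
          (λ x∈D _ → own x∈D) (λ x∈D wx _ → inj₁ (near x∈D (flip– wx)))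
        where
        open Walk W

        length-balls : ∀ cs → length (concatMap ball cs) ≤ length cs * suc s
        length-balls []       = z≤n
        length-balls (c ∷ cs) = ≤-trans (≤-reflexive (length-++ (ball c)))
                                        (+-mono-≤ (length-ball c) (length-balls cs))

        ∈-balls : ∀ {x c cs} → c ∈ cs → x ∈ ball c → x ∈ concatMap ball cs
        ∈-balls (here refl)            x∈ = ∈-++⁺ˡ x∈
        ∈-balls {cs = c ∷ _} (there c∈) x∈ = ∈-++⁺ʳ (ball c) (∈-balls c∈ x∈)

        end : ∀ {x u} → Touched ps x → ¬ Many x → x – u → Many u → u ∈ centres
        end x∈D ¬m xu m with outside x∈D ¬m xu m
        ... | inj₁ u∈cs       = u∈cs
        ... | inj₂ (_ , refl) = t∈cs

        own : ∀ {x} → Touched ps x → x ∈ concatMap ball centres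
        own {x} x∈D with many? x
        ... | yes m = ∈-balls (centre x∈D m) (here refl)
        ... | no ¬m = let c , xc , mc = hook x∈D ¬m in ∈-balls (end x∈D ¬m xc mc) (nbr∈ball (flip– xc))

        near : ∀ {x u} → Touched ps x → x – u → u ∈ concatMap ball centres
        near {x} {u} x∈D xu with many? x | many? u
        ... | yes m | _      = ∈-balls (centre x∈D m) (nbr∈ball xu)
        ... | no ¬m | yes mu = ∈-balls (end x∈D ¬m xu mu) (here refl)
        ... | no ¬m | no ¬mu = own (inside x∈D ¬m xu ¬mu)

        incident : ∀ {x} → Touched ps x → ∃ (x –_)
        incident {x} x∈D with many? x
        ... | yes m = _ , Many.x–u m
        ... | no ¬m = let c , xc , _ = hook x∈D ¬m in c , xc

      -- The new path avoids the old ones: a touched `t` would be a centre, a touched `y` would have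
      -- to be `p` because it is adjacent to the non-centre `t`, and a touched `z` would make `y`
      -- touched by `inside`.
      extend : ∀ {k} {ps : Vec (Vec Vertex 3) k} {p t} (W : Walk ps p t) → ¬ t ∈ Walk.centres W →
               Many t → ∀ {y z t′} → y ≢ p → Thread t y z t′ →
               Walk ((t ∷ y ∷ z ∷ []) ∷ ps) z t′
      extend {k} {ps} {p} {t} W t∉cs mt {y} {z} {t′} y≢p (thread ty tz mt′) = record
        { packing = (isPath (flip– (Two.nbr₁ ty)) (Two.nbr₂ ty) (Two.distinct ty) ∷ proj₁ packing)
                  , (∈⇒All (λ q∈ps → fresh t∉D q∈ps ∷ fresh y∉D q∈ps ∷ fresh z∉D q∈ps ∷ []) ∷ proj₂ packing)
        ; centres = t ∷ centres
        ; size    = cong suc size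
        ; centre  = centre′ ∘ touched-path
        ; hook    = hook′ ∘ touched-path
        ; inside  = inside′ ∘ touched-path
        ; outside = outside′ ∘ touched-path
        }
        where
        open Walk W

        ¬my : ¬ Many y
        ¬my = two⇒¬many ty

        ¬mz : ¬ Many z
        ¬mz = two⇒¬many tz

        t∉D : ¬ Touched ps t
        t∉D t∈D = t∉cs (centre t∈D mt)

        y∉D : ¬ Touched ps y
        y∉D y∈D with outside y∈D ¬my (Two.nbr₁ ty) mt
        ... | inj₁ t∈cs      = t∉cs t∈cs
        ... | inj₂ (y≡p , _) = y≢p y≡p

        z∉D : ¬ Touched ps z
        z∉D z∈D = y∉D (inside z∈D ¬mz (Two.nbr₁ tz) ¬my)

        fresh : ∀ {x q} → ¬ Touched ps x → q Vec.∈ ps → ¬ x Vec.∈ q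
        fresh x∉D q∈ps x∈q = x∉D (VecAny.map (λ { refl → x∈q }) q∈ps)

        OnNew : Vertex → Set
        OnNew x = (x ≡ t ⊎ x ≡ y ⊎ x ≡ z) ⊎ Touched ps x

        centre′ : ∀ {x} → OnNew x → Many x → x ∈ t ∷ centres
        centre′ (inj₁ (inj₁ refl))        _ = here refl
        centre′ (inj₁ (inj₂ (inj₁ refl))) m = ⊥-elim (¬my m)
        centre′ (inj₁ (inj₂ (inj₂ refl))) m = ⊥-elim (¬mz m)
        centre′ (inj₂ x∈D)                m = there (centre x∈D m)

        hook′ : ∀ {x} → OnNew x → ¬ Many x → ∃[ c ] x – c × Many c
        hook′ (inj₁ (inj₁ refl))        ¬m = ⊥-elim (¬m mt)
        hook′ (inj₁ (inj₂ (inj₁ refl))) _  = t , Two.nbr₁ ty , mt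
        hook′ (inj₁ (inj₂ (inj₂ refl))) _  = t′ , Two.nbr₂ tz , mt′
        hook′ (inj₂ x∈D)                ¬m = hook x∈D ¬m

        inside′ : ∀ {x u} → OnNew x → ¬ Many x → x – u → ¬ Many u → Touched ((t ∷ y ∷ z ∷ []) ∷ ps) u
        inside′ (inj₁ (inj₁ refl)) ¬m _ _ = ⊥-elim (¬m mt)
        inside′ (inj₁ (inj₂ (inj₁ refl))) _ yu ¬mu with Two.only ty yu
        ... | inj₁ refl = ⊥-elim (¬mu mt)
        ... | inj₂ refl = here (there (there (here refl)))
        inside′ (inj₁ (inj₂ (inj₂ refl))) _ zu ¬mu with Two.only tz zu
        ... | inj₁ refl = here (there (here refl))
        ... | inj₂ refl = ⊥-elim (¬mu mt′)
        inside′ (inj₂ x∈D) ¬m xu ¬mu = there (inside x∈D ¬m xu ¬mu)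

        outside′ : ∀ {x u} → OnNew x → ¬ Many x → x – u → Many u →
                   u ∈ t ∷ centres ⊎ x ≡ z × u ≡ t′
        outside′ (inj₁ (inj₁ refl)) ¬m _ _ = ⊥-elim (¬m mt)
        outside′ (inj₁ (inj₂ (inj₁ refl))) _ yu mu with Two.only ty yu
        ... | inj₁ refl = inj₁ (here refl)
        ... | inj₂ refl = ⊥-elim (¬mz mu)
        outside′ (inj₁ (inj₂ (inj₂ refl))) _ zu mu with Two.only tz zu
        ... | inj₁ refl = ⊥-elim (¬my mu)
        ... | inj₂ refl = inj₂ (refl , refl)
        outside′ (inj₂ x∈D) ¬m xu mu with outside x∈D ¬m xu mu
        ... | inj₁ u∈cs       = inj₁ (there u∈cs)
        -- The old loose end `t` has just become a centre.
        ... | inj₂ (_ , refl) = inj₁ (here refl)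

      -- Supplies the touched vertex that makes the edge list strictly shorter when the walk closes.
      nonempty : ∀ {k} (ps : Vec (Vec Vertex 3) k) (cs : List Vertex) {t : Vertex} →
                 length cs ≡ k → t ∈ cs → ∃ (Touched ps)
      nonempty ((x ∷ _) ∷ _) _ _ _ = x , here (here refl)
      nonempty [] (_ ∷ _) () _

      -- The fuel suffices because a packing has at most v G paths.
      walk : ∀ fuel {k} {ps : Vec (Vec Vertex 3) k} {p t} → v G < fuel + k → Walk ps p t → Many t → Bound H
      walk zero {ps = ps} v<k W _ = contradiction (≤-trans v<k (packing-bounded G (ps , Walk.packing W))) 1+n≰n
      walk (suc fuel) {k} {ps} {p} {t} v< W mt with DecMembership._∈?_ _≟_ t (Walk.centres W)
      ... | yes t∈cs = close W t∈cs (nonempty ps (Walk.centres W) (Walk.size W) t∈cs)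
      ... | no t∉cs with next-thread mt p
      ...   | inj₁ b = b
      ...   | inj₂ (_ , _ , _ , y≢p , th) =
        walk fuel (subst (v G <_) (sym (+-suc fuel k)) v<) (extend W t∉cs mt y≢p th) (Thread.end th)

      -- The induction step and the induction.

      many-bound : ∀ {t} → Many t → Bound H
      -- No thread precedes the first centre, so `p` defaults to `t`, which excludes no neighbour of
      -- `t`.
      many-bound {t} m = walk (suc (v G)) {p = t} (m≤m+n _ 0) start m
        where
        start : Walk [] t t
        start = record
          { packing = [] , [] ; centres = [] ; size = refl
          ; centre = λ () ; hook = λ () ; inside = λ () ; outside = λ () }

      two-bound : ∀ {x u v} → Two x u v → Bound H
      two-bound {x} {u} {v} t with view u | view v
      ... | isolated none | _ = ⊥-elim (none (flip– (Two.nbr₁ t)))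
      ... | leaf l | _ = leaf-bound l
      ... | many m | _ = many-bound m
      ... | two _  | isolated none = ⊥-elim (none (flip– (Two.nbr₂ t)))
      ... | two _  | leaf l = leaf-bound l
      ... | two _  | many m = many-bound m
      ... | two tu | two tv = two-two-two (proj₂ (orient tu (flip– (Two.nbr₁ t)))) t
                                          (proj₂ (orient tv (flip– (Two.nbr₂ t))))

      bound-step : Bound H
      bound-step with any? (λ x → any? λ u → any? λ v → ¬? (u ≟ v) ×-dec (x –? u) ×-dec (x –? v))
      -- Base of the induction: nothing has to be covered.
      ... | no none = record
        { paths = [] ; packing = [] , [] ; incident = λ () ; cover = [] ; size = z≤n
        ; covers = λ d → contradiction (_ , d) none }
      ... | yes (x , d@(_ , _ , _ , xu , _)) with view x
      ...   | isolated none = ⊥-elim (none xu)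
      ...   | leaf l = ⊥-elim (leaf⇒¬deg2+ l d)
      ...   | two t  = two-bound t
      ...   | many m = many-bound m

    subgraph-bound : 4 ≤ s → (∀ x → degree x ≤ s) → ∀ H → Acc _<_ (length (edges H)) → Bound H
    subgraph-bound 4≤s degree≤s H (acc rs) =
      Reduction.bound-step 4≤s degree≤s H λ H′ shorter → subgraph-bound 4≤s degree≤s H′ (rs shorter)

  -- From subgraphs to the whole graph.

  pairs : List (Vertex × Vertex)
  pairs = cartesianProduct (allFin _) (allFin _)

  ~⇒∈edges : ∀ {x y} → x ~ y → (x , y) ∈ filter (uncurry _~?_) pairs
  ~⇒∈edges = ∈-filter⁺ (uncurry _~?_) (∈-cartesianProduct⁺ (∈-allFin _) (∈-allFin _))

  whole : Subgraph
  whole = record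
    { edges = filter (uncurry _~?_) pairs
    ; –-sym = ~⇒∈edges ∘ ~-sym ∘ ∈edges⇒~
    ; –⇒~   = ∈edges⇒~
    }
    where
    ∈edges⇒~ : ∀ {x y} → (x , y) ∈ filter (uncurry _~?_) pairs → x ~ y
    ∈edges⇒~ = proj₂ ∘ ∈-filter⁻ (uncurry _~?_) {xs = pairs}

  ∈neighbours⇒~ : ∀ {x y} → y Subset.∈ neighbours x → x ~ y
  ∈neighbours⇒~ {x} {y} y∈ with x ~? y | trans (sym (Vecₚ.lookup∘tabulate (does ∘ (x ~?_)) y)) (Vecₚ.[]=⇒lookup y∈)
  ... | yes xy | _  = xy
  ... | no _   | ()

  -- With at most one neighbour in `whole`, the set `neighbours x` would lie inside the empty set or
  -- a singleton.
  degree≥2⇒deg2+ : ∀ {x} → 2 ≤ degree x → Deg2+ whole x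
  degree≥2⇒deg2+ {x} 2≤d with Local.view whole x
  ... | Local.two (Local.two u≢v xu xv _) = _ , _ , u≢v , xu , xv
  ... | Local.many (Local.many u≢v _ _ xu xv _) = _ , _ , u≢v , xu , xv
  ... | Local.isolated none = contradiction (≤-trans 2≤d degree≤0) λ ()
    where
    degree≤0 : degree x ≤ 0
    degree≤0 = ≤-trans (p⊆q⇒∣p∣≤∣q∣ {q = Subset.⊥} λ w∈ → ⊥-elim (none (~⇒∈edges (∈neighbours⇒~ w∈))))
                       (≤-reflexive (∣⊥∣≡0 (v G)))
  ... | Local.leaf {u} (Local.leaf _ only) = contradiction (≤-trans 2≤d degree≤1) λ { (s≤s ()) }
    where
    degree≤1 : degree x ≤ 1
    degree≤1 = ≤-trans (p⊆q⇒∣p∣≤∣q∣ λ w∈ → subst (Subset._∈ ⁅ u ⁆)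
                          (sym (only (~⇒∈edges (∈neighbours⇒~ w∈)))) (x∈⁅x⁆ u))
                       (≤-reflexive (∣⁅x⁆∣≡1 u))

/-mono : ∀ m n s → m ≤ n * suc s → (+ n) / 1 ≥ (+ m) / suc s
/-mono m n s m≤ = toℚᵘ-cancel-≤
  -- `mkℚᵘ` stores the denominator minus one, so `0` and `s` stand for the denominators 1 and
  -- `suc s`.
  (ℚᵘₚ.≤-respʳ-≃ (ℚᵘₚ.≃-sym (toℚᵘ-fromℚᵘ (ℚᵘ.mkℚᵘ (+ n) 0)))
  (ℚᵘₚ.≤-respˡ-≃ (ℚᵘₚ.≃-sym (toℚᵘ-fromℚᵘ (ℚᵘ.mkℚᵘ (+ m) s)))
  (ℚᵘ.*≤* (subst₂ ℤ._≤_ (sym (ℤₚ.*-identityʳ (+ m))) (ℤₚ.pos-* n (suc s)) (ℤ.+≤+ m≤)))))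

theorem1p7 : (s : ℕ) → 4 ≤ s → (G : Graph) → 𝒢 2 s G →
    (+ (λᴳ G)) / 1 ≥ (+ (v G)) / suc s
theorem1p7 s 4≤s G deg = /-mono (v G) (λᴳ G) s
  -- Minimum degree 2 puts every vertex into the cover, and the number of paths found is at most
  -- `λᴳ G`.
  (≤-trans (exhaustive⇒≤length B.cover λ x → B.covers (degree≥2⇒deg2+ G (proj₁ (deg x))))
  (≤-trans B.size (*-monoˡ-≤ (suc s) (proj₂ (λᴳ-isGreatest G) (B.paths , B.packing)))))
  where
  module B = Bound (subgraph-bound G s 4≤s (proj₂ ∘ deg) (whole G) (<-wellFounded _))
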